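{- (Amnesia) In EDPAL, for every agent $a$ and all formulas $\varphi,\psi\in\mathcal{L}^\infty$, the formula $\neg P_a^{d(\varphi)}\to[\varphi]\neg K_a\psi$ is valid, i.e. true in every state of every EDPAL model.
   Context: Fix a set $\mathcal{A}$ of agents and a set $\mathcal{P}$ of propositional atoms; $\mathbb{N}=\{0,1,2,\dots\}$. The language $\mathcal{L}^\infty$ is generated by $\varphi ::= p \mid E_a^d \mid P_a^d \mid \neg\varphi \mid \varphi\wedge\varphi \mid K_a\varphi \mid K_a^\infty\varphi \mid [\varphi]\varphi$ with $p\in\mathcal{P}$, $a\in\mathcal{A}$, $d\in\mathbb{N}$. Other connectives are the usual abbreviations. Modal depth: $d(p)=d(E_a^d)=d(P_a^d)=0$, $d(\neg\varphi)=d(\varphi)$, $d(\varphi\wedge\psi)=\max(d(\varphi),d(\psi))$, $d(K_a\varphi)=d(K_a^\infty\varphi)=1+d(\varphi)$, $d([\varphi]\psi)=d(\varphi)+d(\psi)$. An EDPAL model is a tuple $M=(\mathcal{S},\sim,V,d)$ with $\mathcal{S}$ a set of states, $\sim_a$ an equivalence relation on $\mathcal{S}$ for each agent $a$, $V:\mathcal{S}\to 2^{\mathcal{P}}$, and a depth function $d$ on $\mathcal{A}\times\mathcal{S}$ which may take values in $\mathbb{Z}$. Semantics: $(M,s)\models p$ iff $p\in V(s)$; $(M,s)\models E_a^d$ iff $d(a,s)=d$; $(M,s)\models P_a^d$ iff $d(a,s)\ge d$; $\neg,\wedge$ as usual; $(M,s)\models K_a^\infty\varphi$ iff $(M,s')\models\varphi$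 for all $s'$ with $s\sim_a s'$; $(M,s)\models K_a\varphi$ iff $(M,s)\models P_a^{d(\varphi)}\wedge K_a^\infty\varphi$; $(M,s)\models[\varphi]\psi$ iff ($(M,s)\models\varphi$ implies $(M\mid\varphi,s)\models\psi$), where $M\mid\varphi=(\mathcal{S}',\sim',V,d')$ with $\mathcal{S}'=\{s\in\mathcal{S}:(M,s)\models\varphi\}$, $\sim'_a$ the restriction of $\sim_a$ to $\mathcal{S}'$, $V$ restricted to $\mathcal{S}'$, and $d'(a,s)=d(a,s)-d(\varphi)$. -}

module Defs where

open import Data.Integer.Base as ℤ using (ℤ; +_)
open import Data.Irrelevant using ([_])
open import Data.Nat.Base as ℕ using (ℕ)
open import Data.Product.Base using (_×_)
open import Data.Refinement.Base using (Refinement; value; _,_)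
open import Level using (Level; Lift; suc; _⊔_)
open import Relation.Binary.Construct.On as On using ()
open import Function.Base using (_on_)
open import Relation.Binary.Core using (Rel)
open import Relation.Binary.PropositionalEquality.Core using (_≡_)
open import Relation.Binary.Structures using (IsEquivalence)
open import Relation.Nullary.Negation.Core using (¬_)
open import Relation.Unary using (Pred)

infix  9 ~_
infixr 8 ⟦_⟧_
infixr 7 _∧_
infixr 5 _⇒_

data Formula {a p} (𝒜 : Set a) (𝒫 : Set p) : Set (a ⊔ p) where
  atom : 𝒫 → Formula 𝒜 𝒫
  E    : 𝒜 → ℕ → Formula 𝒜 𝒫
  P    : 𝒜 → ℕ → Formula 𝒜 𝒫
  ~_   : Formula 𝒜 𝒫 → Formula 𝒜 𝒫
  _∧_  : Formula 𝒜 𝒫 → Formula 𝒜 𝒫 → Formula 𝒜 𝒫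
  K    : 𝒜 → Formula 𝒜 𝒫 → Formula 𝒜 𝒫
  K∞   : 𝒜 → Formula 𝒜 𝒫 → Formula 𝒜 𝒫
  ⟦_⟧_ : Formula 𝒜 𝒫 → Formula 𝒜 𝒫 → Formula 𝒜 𝒫

_⇒_ : ∀ {a p} {𝒜 : Set a} {𝒫 : Set p} →
      Formula 𝒜 𝒫 → Formula 𝒜 𝒫 → Formula 𝒜 𝒫
φ ⇒ ψ = ~ (φ ∧ ~ ψ)

modalDepth : ∀ {a p} {𝒜 : Set a} {𝒫 : Set p} → Formula 𝒜 𝒫 → ℕ
modalDepth (atom _)  = 0
modalDepth (E _ _)   = 0
modalDepth (P _ _)   = 0
modalDepth (~ φ)     = modalDepth φ
modalDepth (φ ∧ ψ)   = modalDepth φ ℕ.⊔ modalDepth ψ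
modalDepth (K _ φ)   = 1 ℕ.+ modalDepth φ
modalDepth (K∞ _ φ)  = 1 ℕ.+ modalDepth φ
modalDepth (⟦ φ ⟧ ψ) = modalDepth φ ℕ.+ modalDepth ψ

record Model {a p} (𝒜 : Set a) (𝒫 : Set p) (ℓ : Level) : Set (a ⊔ p ⊔ suc ℓ) where
  field
    State  : Set ℓ
    acc    : 𝒜 → Rel State ℓ
    accEq  : ∀ i → IsEquivalence (acc i)
    val    : State → Pred 𝒫 ℓ
    depth  : 𝒜 → State → ℤ

open Model public using (State)

infix 4 _,_⊨_
infixl 6 _∣_

-- The states of M ∣ φ carry their proof of φ irrelevantly, so that they form a
-- subset of the states of M: a state is never duplicated by distinct proofs.
mutual
  _∣_ : ∀ {a p ℓ} {𝒜 : Set a} {𝒫 : Set p} →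
        Model 𝒜 𝒫 ℓ → Formula 𝒜 𝒫 → Model 𝒜 𝒫 ℓ
  M ∣ φ = record
    { State = Refinement (State M) (λ s → M , s ⊨ φ)
    ; acc   = λ i → Model.acc M i on value
    ; accEq = λ i → On.isEquivalence value (Model.accEq M i)
    ; val   = λ s → Model.val M (value s)
    ; depth = λ i s → Model.depth M i (value s) ℤ.- + modalDepth φ
    }

  _,_⊨_ : ∀ {a p ℓ} {𝒜 : Set a} {𝒫 : Set p} (M : Model 𝒜 𝒫 ℓ) →
          State M → Formula 𝒜 𝒫 → Set ℓ
  M , s ⊨ atom q      = Model.val M s q
  _,_⊨_ {ℓ = ℓ} M s (E i n) = Lift ℓ (Model.depth M i s ≡ + n)
  _,_⊨_ {ℓ = ℓ} M s (P i n) = Lift ℓ (Model.depth M i s ℤ.≥ + n)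
  M , s ⊨ (~ φ)       = ¬ (M , s ⊨ φ)
  M , s ⊨ (φ ∧ ψ)     = (M , s ⊨ φ) × (M , s ⊨ ψ)
  -- The clauses of P i (modalDepth φ) and K∞ i φ, unfolded so that the
  -- recursion is structural.
  _,_⊨_ {ℓ = ℓ} M s (K i φ) =
    Lift ℓ (Model.depth M i s ℤ.≥ + modalDepth φ) ×
    (∀ s′ → Model.acc M i s s′ → M , s′ ⊨ φ)
  M , s ⊨ K∞ i φ      = ∀ s′ → Model.acc M i s s′ → M , s′ ⊨ φ
  M , s ⊨ (⟦ φ ⟧ ψ)   = (h : M , s ⊨ φ) → (M ∣ φ) , (s , [ h ]) ⊨ ψ

Valid : ∀ {a p} {𝒜 : Set a} {𝒫 : Set p} (ℓ : Level) → Formula 𝒜 𝒫 → Set (a ⊔ p ⊔ suc ℓ)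
Valid {𝒜 = 𝒜} {𝒫} ℓ φ = (M : Model 𝒜 𝒫 ℓ) (s : State M) → M , s ⊨ φ

{-# OPTIONS --safe #-}
module Submission where

open import Defs
open import Level using (Level; lift)
open import Data.Integer.Base using (+≤+)
open import Data.Integer.Properties using (≤-trans; 0≤i-j⇒j≤i)
open import Data.Nat.Base using (z≤n)
open import Data.Product.Base using (_,_)

proposition3p3 : {a p ℓ : Level} {𝒜 : Set a} {𝒫 : Set p}
    (i : 𝒜) (φ ψ : Formula 𝒜 𝒫) →
    Valid ℓ (~ P i (modalDepth φ) ⇒ ⟦ φ ⟧ (~ K i ψ))
-- `⇒` unfolds to a negated conjunction, so no case split on `P` is needed: the announcement formula
-- is proved outright and fed to `¬forgets`.
proposition3p3 i φ ψ M s (¬deep , ¬forgets) =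
  ¬forgets λ { _ (lift dψ≤d-dφ , _) →
    -- Knowing `ψ` after the update requires depth at least `modalDepth ψ`, hence at least 0. The
    -- update subtracted `modalDepth φ`, so the original depth was at least that, contradicting
    -- `¬deep`.
    ¬deep (lift (0≤i-j⇒j≤i (≤-trans (+≤+ z≤n) dψ≤d-dφ))) }
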